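{- Let $p$ be an odd prime, let $n$ be a positive integer, and let $$n=a_0+a_1p+a_2p^2+\cdots+a_kp^k,\qquad a_j\in\{0,1,\ldots,p-1\},$$ be the base $p$ expansion of $n$. Then $$L_p(n):=\sum_{l=1}^n\lambda_p(l)=\sum_{l=1}^{a_0}\lambda_p(l)+\sum_{l=1}^{a_1}\lambda_p(l)+\cdots+\sum_{l=1}^{a_k}\lambda_p(l),$$ where a sum $\sum_{l=1}^{a_j}$ is regarded as empty if $a_j=0$.
   Context: For a prime $p$, $\lambda_p(n)=(-1)^{\Omega_p(n)}$, where $\Omega_p(n)$ is the number of prime factors $q$ of $n$, counted with multiplicity, with Legendre symbol $\left(\frac{q}{p}\right)=-1$. Equivalently, $\lambda_p$ is the completely multiplicative function with $\lambda_p(p)=1$ and $\lambda_p(q)=\left(\frac{q}{p}\right)$ for primes $q\ne p$; thus $\lambda_p(p^km)=\left(\frac{m}{p}\right)$ when $p\nmid m$. -}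

module Defs where

open import Algebra.Properties.CommutativeMonoid.Sum as Sum using ()
open import Data.Bool.Base using (if_then_else_)
open import Data.Fin.Base using (Fin; toℕ; fromℕ<)
open import Data.Fin.Properties using (any?; toℕ-fromℕ<)
open import Data.Integer.Base as ℤ using (ℤ; 0ℤ; 1ℤ; -1ℤ)
open import Data.Integer.Properties as ℤ using ()
open import Data.List.Base using (filter; length)
open import Data.Nat.Base using (ℕ; suc; _*_; _%_; NonZero)
open import Data.Nat.Divisibility using (_∣?_)
open import Data.Nat.DivMod using (m%n<n; %-distribˡ-*)
open import Data.Nat.Primality.Factorisation using (factorise; factors)
open import Data.Nat.Properties as ℕ using (_≟_)
open import Data.Product.Base using (∃-syntax; _,_)
open import Data.Vec.Functional using (Vector)
open import Relation.Binary.PropositionalEquality using (_≡_; sym; trans; cong)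
open import Relation.Nullary.Decidable using (Dec; does; map′)

∑ℕ : ∀ {n} → Vector ℕ n → ℕ
∑ℕ = Sum.sum ℕ.+-0-commutativeMonoid

∑ℤ : ∀ {n} → Vector ℤ n → ℤ
∑ℤ = Sum.sum ℤ.+-0-commutativeMonoid

module _ (p : ℕ) .{{_ : NonZero p}} where

  SquareMod : ℕ → Set
  SquareMod a = ∃[ x ] (x * x) % p ≡ a % p

  squareMod? : ∀ a → Dec (SquareMod a)
  squareMod? a = map′ (λ (x , eq) → toℕ x , eq) reduce
    (any? λ (x : Fin p) → (toℕ x * toℕ x) % p ≟ a % p)
    where
    reduce : SquareMod a → ∃[ x ] (toℕ {p} x * toℕ x) % p ≡ a % p
    reduce (x , eq) = fromℕ< (m%n<n x p) ,
      trans (cong (λ r → (r * r) % p) (toℕ-fromℕ< (m%n<n x p)))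
            (trans (sym (%-distribˡ-* x x p)) eq)

  legendre : ℕ → ℤ
  legendre a =
    if does (p ∣? a) then 0ℤ else
    if does (squareMod? a) then 1ℤ else -1ℤ

  Ω : ∀ n .{{_ : NonZero n}} → ℕ
  Ω n = length (filter (λ q → legendre q ℤ.≟ -1ℤ) (factors (factorise n)))

  λₚ : ∀ n .{{_ : NonZero n}} → ℤ
  λₚ n = -1ℤ ℤ.^ Ω n

  -- The index i stands for the summand l = i + 1.
  L : ℕ → ℤ
  L n = ∑ℤ {n} λ i → λₚ (suc (toℕ i))

{-# OPTIONS --safe #-}
-- Off the multiples of p the function λₚ is the Legendre symbol χ, and λₚ (p m) = λₚ m.
-- As χ is p-periodic with sum 0 over a period, each block of p consecutive arguments
-- m p + 1, …, m p + p contributes λₚ (m + 1), whence L (r + m p) = L r + L m for r < p;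
-- iterating strips off the digits.  Both the vanishing of the sum and the
-- multiplicativity of χ come from counting the solutions of y² ≡ a x (mod p):
-- fixing x gives 1 + χ (a x), fixing y gives 1.
module Submission where

open import Defs
open import Algebra.Bundles using (AbelianGroup)
open import Algebra.Properties.CommutativeMonoid.Sum as Sum using ()
import Algebra.Properties.Group
open import Data.Bool.Base using (if_then_else_)
open import Data.Fin.Base using (Fin; toℕ; fromℕ<; zero; suc; punchIn)
open import Data.Fin.Properties using (toℕ-fromℕ<; toℕ-injective; toℕ<n; toℕ-fromℕ;
  toℕ-inject₁; punchInᵢ≢i)
open import Data.Integer.Base as ℤ using (ℤ; 0ℤ; 1ℤ; -1ℤ; +≤+; -≤+)
open import Data.Integer.Properties as ℤ using ()
open import Data.List.Base using (List; []; _∷_; filter; length)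
open import Data.List.Relation.Binary.Permutation.Propositional.Properties using (filter-↭; ↭-length)
open import Data.List.Relation.Unary.All using (All; []; _∷_)
open import Data.Nat.Base using (ℕ; zero; suc; pred; _+_; _*_; _^_; _%_; _<_; z≤n; NonZero)
open import Data.Nat.Coprimality using (coprime-Bézout; prime⇒coprime)
open import Data.Nat.Divisibility
open import Data.Nat.DivMod
open import Data.Nat.GCD using (module Bézout)
open import Data.Nat.ListAction using (product)
open import Data.Nat.Primality using (Prime; euclidsLemma; prime⇒irreducible; prime[2]; ¬prime[1])
open import Data.Nat.Primality.Factorisation
open import Data.Nat.Properties as ℕ using (_≟_)
open import Data.Nat.Tactic.RingSolver using (solve-∀)
open import Data.Product.Base using (∃-syntax; _,_)
open import Data.Sum.Base using (_⊎_; inj₁; inj₂; [_,_]′; reduce)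
open import Data.Vec.Functional using (Vector)
open import Function.Base using (_∘_)
open import Relation.Binary.Bundles using (Setoid)
open import Relation.Nullary using (¬_; Dec; yes; no; contradiction; does)
open import Relation.Nullary.Decidable using (dec-true; dec-false; map′)
open import Relation.Binary.PropositionalEquality

private module ℤ+ = Algebra.Properties.Group (AbelianGroup.group ℤ.+-0-abelianGroup)

open Sum ℕ.+-0-commutativeMonoid using () renaming (sum-cong-≗ to ℕ-sum-cong)
open Sum ℤ.+-0-commutativeMonoid
  using (sum-cong-≗; sum-remove; sum-replicate-zero; ∑-distrib-+; ∑-comm; sum-init-last)

private
  variable
    n : ℕ
    A B C : Set

-- Indicator values and finite sums.

ℤ-+-congˡ : ∀ i {j k} → j ≡ k → i ℤ.+ j ≡ i ℤ.+ k
ℤ-+-congˡ i refl = refl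

𝟙 : Dec A → ℤ
𝟙 A? = if does A? then 1ℤ else 0ℤ

𝟙-true : (A? : Dec A) → A → 𝟙 A? ≡ 1ℤ
𝟙-true A? a = cong (if_then 1ℤ else 0ℤ) (dec-true A? a)

𝟙-false : (A? : Dec A) → ¬ A → 𝟙 A? ≡ 0ℤ
𝟙-false A? ¬a = cong (if_then 1ℤ else 0ℤ) (dec-false A? ¬a)

𝟙-cong : (A? : Dec A) (B? : Dec B) → (A → B) → (B → A) → 𝟙 A? ≡ 𝟙 B?
𝟙-cong (yes a) B? f g = sym (𝟙-true B? (f a))
𝟙-cong (no ¬a) B? f g = sym (𝟙-false B? (¬a ∘ g))

𝟙-⊎ : (A? : Dec A) (B? : Dec B) (C? : Dec C) →
      (A → B ⊎ C) → (B → A) → (C → A) → (B → ¬ C) → 𝟙 A? ≡ 𝟙 B? ℤ.+ 𝟙 C?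
𝟙-⊎ A? (yes b) C? f g h d = trans (𝟙-true A? (g b)) (sym (ℤ-+-congˡ 1ℤ (𝟙-false C? (d b))))
𝟙-⊎ A? (no ¬b) (yes c) f g h d = 𝟙-true A? (h c)
𝟙-⊎ A? (no ¬b) (no ¬c) f g h d = 𝟙-false A? ([ ¬b , ¬c ]′ ∘ f)

∑ℤ-zero : (f : Vector ℤ n) → (∀ i → f i ≡ 0ℤ) → ∑ℤ f ≡ 0ℤ
∑ℤ-zero {n} f f≡0 = trans (sum-cong-≗ f≡0) (sum-replicate-zero n)

∑ℤ-𝟙-unique : {P : Fin n → Set} (P? : ∀ i → Dec (P i)) (j : Fin n) →
              P j → (∀ i → P i → i ≡ j) → ∑ℤ (λ i → 𝟙 (P? i)) ≡ 1ℤ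
∑ℤ-𝟙-unique {suc n} P? j Pj unique = trans (sum-remove {i = j} (𝟙 ∘ P?))
  (cong₂ ℤ._+_ (𝟙-true (P? j) Pj)
    (∑ℤ-zero _ λ i → 𝟙-false (P? (punchIn j i)) (punchInᵢ≢i j i ∘ unique _)))

∑ℤ-nonPos : (f : Vector ℤ n) → (∀ i → f i ℤ.≤ 0ℤ) → ∑ℤ f ℤ.≤ 0ℤ
∑ℤ-nonPos {zero}  f f≤0 = ℤ.≤-refl
∑ℤ-nonPos {suc n} f f≤0 = ℤ.+-mono-≤ (f≤0 zero) (∑ℤ-nonPos (f ∘ suc) (f≤0 ∘ suc))

-- Since `j` is not positive, `0 = i + j` is at most `i`; antisymmetry does the rest.
+-nonPos-≡0ˡ : ∀ {i j} → i ℤ.≤ 0ℤ → j ℤ.≤ 0ℤ → i ℤ.+ j ≡ 0ℤ → i ≡ 0ℤ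
+-nonPos-≡0ˡ {i} {j} i≤0 j≤0 eq = ℤ.≤-antisym i≤0
  (subst₂ ℤ._≤_ eq (ℤ.+-identityʳ i) (ℤ.+-monoʳ-≤ i j≤0))

∑ℤ-nonPos-≡0 : (f : Vector ℤ n) → (∀ i → f i ℤ.≤ 0ℤ) → ∑ℤ f ≡ 0ℤ → ∀ i → f i ≡ 0ℤ
∑ℤ-nonPos-≡0 f f≤0 eq zero    = +-nonPos-≡0ˡ (f≤0 zero) (∑ℤ-nonPos (f ∘ suc) (f≤0 ∘ suc)) eq
-- For a later index the roles are exchanged: the head is the non-positive companion, and the sum of
-- the tail is what is shown to vanish before recursing.
∑ℤ-nonPos-≡0 f f≤0 eq (suc i) = ∑ℤ-nonPos-≡0 (f ∘ suc) (f≤0 ∘ suc)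
  (+-nonPos-≡0ˡ (∑ℤ-nonPos (f ∘ suc) (f≤0 ∘ suc)) (f≤0 zero)
    (trans (ℤ.+-comm (∑ℤ (f ∘ suc)) (f zero)) eq)) i

∑ℤ-+ : ∀ m n (f : ℕ → ℤ) →
       ∑ℤ {m + n} (f ∘ toℕ) ≡ ∑ℤ {m} (f ∘ toℕ) ℤ.+ ∑ℤ {n} (λ i → f (m + toℕ i))
∑ℤ-+ zero    n f = sym (ℤ.+-identityˡ _)
∑ℤ-+ (suc m) n f = trans (ℤ-+-congˡ (f 0) (∑ℤ-+ m n (f ∘ suc))) (sym (ℤ.+-assoc (f 0) _ _))

∑ℤ-snoc : ∀ n (f : ℕ → ℤ) → ∑ℤ {suc n} (f ∘ toℕ) ≡ ∑ℤ {n} (f ∘ toℕ) ℤ.+ f n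
∑ℤ-snoc n f = trans (sum-init-last {n} (f ∘ toℕ))
  (cong₂ ℤ._+_ (sum-cong-≗ {n} λ i → cong f (toℕ-inject₁ i)) (cong f (toℕ-fromℕ n)))

∑ℕ-*ʳ : ∀ m (f : Vector ℕ n) → ∑ℕ (λ i → f i * m) ≡ ∑ℕ f * m
∑ℕ-*ʳ {zero}  m f = refl
∑ℕ-*ʳ {suc n} m f = trans (cong (f zero * m +_) (∑ℕ-*ʳ m (f ∘ suc)))
  (sym (ℕ.*-distribʳ-+ m (f zero) (∑ℕ (f ∘ suc))))

-- Congruence modulo `p`, and the Legendre symbol as a function of the residue class.

module Modular (p : ℕ) .{{_ : NonZero p}} where

  open ≡-Reasoning

  -- A record, so that unification recovers x and y from the type.
  infix 4 _≈_ _≈?_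
  record _≈_ (x y : ℕ) : Set where
    constructor mk
    field %-≡ : x % p ≡ y % p
  open _≈_ public

  _≈?_ : ∀ x y → Dec (x ≈ y)
  x ≈? y = map′ mk %-≡ (x % p ≟ y % p)

  ≈-refl : ∀ {x} → x ≈ x
  ≈-refl = mk refl

  ≈-reflexive : ∀ {x y} → x ≡ y → x ≈ y
  ≈-reflexive refl = ≈-refl

  ≈-sym : ∀ {x y} → x ≈ y → y ≈ x
  ≈-sym (mk eq) = mk (sym eq)

  ≈-trans : ∀ {x y z} → x ≈ y → y ≈ z → x ≈ z
  ≈-trans (mk eq) (mk eq′) = mk (trans eq eq′)

  ≈-setoid : Setoid _ _
  ≈-setoid = record
    { _≈_           = _≈_
    ; isEquivalence = record { refl = ≈-refl ; sym = ≈-sym ; trans = ≈-trans }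
    }

  +-cong : ∀ {x x′ y y′} → x ≈ x′ → y ≈ y′ → x + y ≈ x′ + y′
  +-cong {x} {x′} {y} {y′} (mk eq) (mk eq′) = mk (begin
    (x + y) % p              ≡⟨ %-distribˡ-+ x y p ⟩
    (x % p + y % p) % p      ≡⟨ cong₂ (λ r s → (r + s) % p) eq eq′ ⟩
    (x′ % p + y′ % p) % p    ≡⟨ %-distribˡ-+ x′ y′ p ⟨
    (x′ + y′) % p            ∎)

  *-cong : ∀ {x x′ y y′} → x ≈ x′ → y ≈ y′ → x * y ≈ x′ * y′
  *-cong {x} {x′} {y} {y′} (mk eq) (mk eq′) = mk (begin
    (x * y) % p              ≡⟨ %-distribˡ-* x y p ⟩
    (x % p * (y % p)) % p    ≡⟨ cong₂ (λ r s → (r * s) % p) eq eq′ ⟩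
    (x′ % p * (y′ % p)) % p  ≡⟨ %-distribˡ-* x′ y′ p ⟨
    (x′ * y′) % p            ∎)

  *-congˡ : ∀ x {y y′} → y ≈ y′ → x * y ≈ x * y′
  *-congˡ x = *-cong (≈-refl {x})

  *-congʳ : ∀ y {x x′} → x ≈ x′ → x * y ≈ x′ * y
  *-congʳ y eq = *-cong eq (≈-refl {y})

  +-multiple : ∀ x k → x + k * p ≈ x
  +-multiple x k = mk ([m+kn]%n≡m%n x k p)

  %-≈ : ∀ x → x % p ≈ x
  %-≈ x = mk (m%n%n≡m%n x p)

  %⇒≈ : ∀ {x r} → x % p ≡ r → x ≈ r
  %⇒≈ {x} eq = ≈-trans (≈-sym (%-≈ x)) (≈-reflexive eq)

  ∣⇒≈0 : ∀ {x} → p ∣ x → x ≈ 0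
  ∣⇒≈0 {x} p∣x = mk (trans (n∣m⇒m%n≡0 x p p∣x) (sym (n∣m⇒m%n≡0 0 p (p ∣0))))

  ≈0⇒∣ : ∀ {x} → x ≈ 0 → p ∣ x
  ≈0⇒∣ {x} (mk eq) = m%n≡0⇒n∣m x p (trans eq (n∣m⇒m%n≡0 0 p (p ∣0)))

  ≈-resp-∣ : ∀ {x y} → x ≈ y → p ∣ x → p ∣ y
  ≈-resp-∣ x≈y p∣x = ≈0⇒∣ (≈-trans (≈-sym x≈y) (∣⇒≈0 p∣x))

  +-identityˡ-≈ : ∀ x {y} → y ≈ 0 → y + x ≈ x
  +-identityˡ-≈ x {y} y≈0 = +-cong {y} {0} {x} {x} y≈0 ≈-refl

  +-identityʳ-≈ : ∀ x {y} → y ≈ 0 → x + y ≈ x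
  +-identityʳ-≈ x {y} y≈0 = ≈-trans (≈-reflexive (ℕ.+-comm x y)) (+-identityˡ-≈ x y≈0)

  -- pred p represents −1.
  neg : ℕ → ℕ
  neg x = pred p * x

  neg-inverseˡ : ∀ x → neg x + x ≈ 0
  neg-inverseˡ x = ∣⇒≈0 (divides x (begin
    pred p * x + x    ≡⟨ ℕ.+-comm (pred p * x) x ⟩
    suc (pred p) * x  ≡⟨ cong (_* x) (ℕ.suc-pred p) ⟩
    p * x             ≡⟨ ℕ.*-comm p x ⟩
    x * p             ∎))

  +-neg-cancel : ∀ x y → x + neg y + y ≈ x
  +-neg-cancel x y = ≈-trans (≈-reflexive (ℕ.+-assoc x (neg y) y))
    (+-identityʳ-≈ x (neg-inverseˡ y))

  toFin : ℕ → Fin p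
  toFin x = fromℕ< (m%n<n x p)

  toℕ-toFin : ∀ x → toℕ (toFin x) ≈ x
  toℕ-toFin x = ≈-trans (≈-reflexive (toℕ-fromℕ< (m%n<n x p))) (%-≈ x)

  toℕ-≈-injective : ∀ {i j : Fin p} → toℕ i ≈ toℕ j → i ≡ j
  toℕ-≈-injective {i} {j} (mk eq) = toℕ-injective (begin
    toℕ i      ≡⟨ m<n⇒m%n≡m (toℕ<n i) ⟨
    toℕ i % p  ≡⟨ eq ⟩
    toℕ j % p  ≡⟨ m<n⇒m%n≡m (toℕ<n j) ⟩
    toℕ j      ∎)

  count-≈ : ∀ c → ∑ℤ (λ (y : Fin p) → 𝟙 (toℕ y ≈? c)) ≡ 1ℤ
  count-≈ c = ∑ℤ-𝟙-unique (λ i → toℕ i ≈? c) (toFin c) (toℕ-toFin c)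
    λ i i≈c → toℕ-≈-injective (≈-trans i≈c (≈-sym (toℕ-toFin c)))

  SquareMod-resp-≈ : ∀ {x y} → x ≈ y → SquareMod p x → SquareMod p y
  SquareMod-resp-≈ (mk x≈y) (z , eq) = z , trans eq x≈y

  legendre-∣ : ∀ {a} → p ∣ a → legendre p a ≡ 0ℤ
  legendre-∣ {a} p∣a rewrite dec-true (p ∣? a) p∣a = refl

  legendre-square : ∀ {a} → p ∤ a → SquareMod p a → legendre p a ≡ 1ℤ
  legendre-square {a} p∤a s
    rewrite dec-false (p ∣? a) p∤a | dec-true (squareMod? p a) s = refl

  legendre-nonsquare : ∀ {a} → p ∤ a → ¬ SquareMod p a → legendre p a ≡ -1ℤ
  legendre-nonsquare {a} p∤a ¬s
    rewrite dec-false (p ∣? a) p∤a | dec-false (squareMod? p a) ¬s = refl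

  -- Each case carries both its arithmetic reason and the resulting value of the symbol, so a single
  -- match gives the equation to rewrite with and the facts that go with it.
  data Character (a : ℕ) : Set where
    multiple  : p ∣ a → legendre p a ≡ 0ℤ → Character a
    square    : p ∤ a → SquareMod p a → legendre p a ≡ 1ℤ → Character a
    nonsquare : p ∤ a → ¬ SquareMod p a → legendre p a ≡ -1ℤ → Character a

  character : ∀ a → Character a
  character a with p ∣? a
  ... | yes p∣a = multiple p∣a (legendre-∣ p∣a)
  ... | no p∤a with squareMod? p a
  ...   | yes s = square p∤a s (legendre-square p∤a s)
  ...   | no ¬s = nonsquare p∤a ¬s (legendre-nonsquare p∤a ¬s)

  legendre-cong : ∀ {x y} → x ≈ y → legendre p x ≡ legendre p y
  legendre-cong {x} {y} x≈y with character x
  ... | multiple p∣x eq = trans eq (sym (legendre-∣ (≈-resp-∣ x≈y p∣x)))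
  ... | square p∤x s eq = trans eq
    (sym (legendre-square (p∤x ∘ ≈-resp-∣ (≈-sym x≈y)) (SquareMod-resp-≈ x≈y s)))
  ... | nonsquare p∤x ¬s eq = trans eq
    (sym (legendre-nonsquare (p∤x ∘ ≈-resp-∣ (≈-sym x≈y)) (¬s ∘ SquareMod-resp-≈ (≈-sym x≈y))))

-- Inverses, square roots and quotients modulo a prime.

module PrimeModulus (p : ℕ) .{{_ : NonZero p}} (prime : Prime p) where

  open Modular p
  open import Relation.Binary.Reasoning.Setoid ≈-setoid

  p∤1 : p ∤ 1
  p∤1 p∣1 = ¬prime[1] (subst Prime (∣1⇒≡1 p∣1) prime)

  p∤* : ∀ {x y} → p ∤ x → p ∤ y → p ∤ x * y
  p∤* {x} {y} p∤x p∤y p∣xy = [ p∤x , p∤y ]′ (euclidsLemma x y prime p∣xy)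

  -- A nonzero residue `r` of `a` is less than the prime `p`, hence coprime to it, and the Bézout
  -- coefficient of `r` is an inverse up to sign.
  inverse : ∀ {a} → p ∤ a → ∃[ b ] b * a ≈ 1
  inverse {a} p∤a with a % p in eq
  ... | zero = contradiction (m%n≡0⇒n∣m a p eq) p∤a
  ... | r@(suc _) with coprime-Bézout (prime⇒coprime prime (subst (_< p) eq (m%n<n a p)))
  ...   | Bézout.-+ x y e = y , (begin
    y * a       ≈⟨ *-congˡ y (%⇒≈ eq) ⟩
    y * r       ≡⟨ e ⟨
    1 + x * p   ≈⟨ +-multiple 1 x ⟩
    1           ∎)
  -- Here the identity reads `1 + y * r ≡ x * p`, so `y * r` represents -1 and the sign is moved
  -- onto `y`.
  ...   | Bézout.+- x y e = neg y , (begin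
    neg y * a                         ≈⟨ *-congˡ (neg y) (%⇒≈ eq) ⟩
    neg y * r                         ≈⟨ +-identityʳ-≈ (neg y * r) (∣⇒≈0 (divides x e)) ⟨
    neg y * r + (1 + y * r)           ≡⟨ rearrange (pred p) y r ⟩
    1 + (neg (y * r) + y * r)         ≈⟨ +-identityʳ-≈ 1 (neg-inverseˡ (y * r)) ⟩
    1                                 ∎)
    where
    rearrange : ∀ q y r → q * y * r + (1 + y * r) ≡ 1 + (q * (y * r) + y * r)
    rearrange = solve-∀

  -- Multiplying by the inverse `b` of `a` turns the congruence into `x ≈ b * c`, which has one
  -- representative in `Fin p`.
  count-*-≈ : ∀ {a} → p ∤ a → ∀ c → ∑ℤ (λ (x : Fin p) → 𝟙 (c ≈? a * toℕ x)) ≡ 1ℤ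
  count-*-≈ {a} p∤a c with inverse p∤a
  ... | b , ba≈1 = trans
    (sum-cong-≗ {p} λ x → 𝟙-cong (c ≈? _) (toℕ x ≈? b * c) (⇒ (toℕ x)) (⇐ (toℕ x)))
    (count-≈ (b * c))
    where
    ⇒ : ∀ x → c ≈ a * x → x ≈ b * c
    ⇒ x c≈ax = begin
      x            ≡⟨ ℕ.*-identityˡ x ⟨
      1 * x        ≈⟨ *-congʳ x ba≈1 ⟨
      b * a * x    ≡⟨ ℕ.*-assoc b a x ⟩
      b * (a * x)  ≈⟨ *-congˡ b c≈ax ⟨
      b * c        ∎
    rearrange : ∀ a b c → b * a * c ≡ a * (b * c)
    rearrange = solve-∀
    ⇐ : ∀ x → x ≈ b * c → c ≈ a * x
    ⇐ x x≈bc = begin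
      c            ≡⟨ ℕ.*-identityˡ c ⟨
      1 * c        ≈⟨ *-congʳ c ba≈1 ⟨
      b * a * c    ≡⟨ rearrange a b c ⟩
      a * (b * c)  ≈⟨ *-congˡ a x≈bc ⟨
      a * x        ∎

  -- Euclid's lemma applied to `(y + z)(y − z) = y² − z²`. As `neg` stands in for subtraction, the
  -- cross terms `neg (y * z) + y * z` vanish only modulo `p`.
  square-roots : ∀ {y z} → y * y ≈ z * z → y ≈ z ⊎ y ≈ neg z
  square-roots {y} {z} y²≈z² = [ inj₂ ∘ fromSum , inj₁ ∘ fromDifference ]′
    (euclidsLemma (y + z) (y + neg z) prime (≈0⇒∣ product≈0))
    where
    expand : ∀ q y z → (y + z) * (y + q * z) ≡ y * y + q * (z * z) + (q * (y * z) + y * z)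
    expand = solve-∀
    product≈0 : (y + z) * (y + neg z) ≈ 0
    product≈0 = begin
      (y + z) * (y + neg z)                              ≡⟨ expand (pred p) y z ⟩
      y * y + neg (z * z) + (neg (y * z) + y * z)        ≈⟨ +-identityʳ-≈ _ (neg-inverseˡ (y * z)) ⟩
      y * y + neg (z * z)                                ≈⟨ +-cong y²≈z² (≈-refl {neg (z * z)}) ⟩
      z * z + neg (z * z)                                ≡⟨ ℕ.+-comm (z * z) _ ⟩
      neg (z * z) + z * z                                ≈⟨ neg-inverseˡ (z * z) ⟩
      0                                                  ∎
    fromDifference : p ∣ y + neg z → y ≈ z
    fromDifference d = ≈-trans (≈-sym (+-neg-cancel y z)) (+-identityˡ-≈ z (∣⇒≈0 d))
    swapped : ∀ y z w → y + w + z ≡ y + z + w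
    swapped = solve-∀
    fromSum : p ∣ y + z → y ≈ neg z
    fromSum d = begin
      y              ≈⟨ +-neg-cancel y z ⟨
      y + neg z + z  ≡⟨ swapped y z (neg z) ⟩
      y + z + neg z  ≈⟨ +-identityˡ-≈ (neg z) (∣⇒≈0 d) ⟩
      neg z          ∎

  -- That `pred p` squares to 1 is not a polynomial identity. Adding `neg (z * z) + z * z`, which is
  -- 0 modulo `p`, makes `neg z + z` split off as a factor by pure algebra.
  neg-*-neg : ∀ z → neg z * neg z ≈ z * z
  neg-*-neg z = begin
    neg z * neg z                          ≈⟨ +-identityʳ-≈ (neg z * neg z) (neg-inverseˡ (z * z)) ⟨
    neg z * neg z + (neg (z * z) + z * z)  ≡⟨ rearrange (pred p) z ⟩
    (neg z + z) * neg z + z * z            ≈⟨ +-identityˡ-≈ (z * z) (*-congʳ (neg z) (neg-inverseˡ z)) ⟩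
    z * z                                  ∎
    where
    rearrange : ∀ q z → q * z * (q * z) + (q * (z * z) + z * z) ≡ (q * z + z) * (q * z) + z * z
    rearrange = solve-∀

  -- This is where oddness of `p` enters: `z ≈ neg z` would make `p` divide `2 * z`. It keeps the
  -- two roots of a square distinct.
  ≉-neg : ∀ {z} → p ∤ 2 → p ∤ z → ¬ z ≈ neg z
  ≉-neg {z} p∤2 p∤z z≈-z = p∤* p∤2 p∤z (≈0⇒∣ (begin
    2 * z      ≡⟨ double z ⟩
    z + z      ≈⟨ +-cong {z} {neg z} z≈-z (≈-refl {z}) ⟩
    neg z + z  ≈⟨ neg-inverseˡ z ⟩
    0          ∎))
    where
    double : ∀ z → 2 * z ≡ z + z
    double = solve-∀

  square-* : ∀ {a b} → SquareMod p a → SquareMod p b → SquareMod p (a * b)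
  square-* {a} {b} (w , w²≡a) (z , z²≡b) = w * z , %-≡ (begin
    w * z * (w * z)  ≡⟨ rearrange w z ⟩
    w * w * (z * z)  ≈⟨ *-cong {w * w} {a} {z * z} {b} (mk w²≡a) (mk z²≡b) ⟩
    a * b            ∎)
    where
    rearrange : ∀ w z → w * z * (w * z) ≡ w * w * (z * z)
    rearrange = solve-∀

  -- If `w` is a root of `a * b` and `z` a root of `b`, the quotient of `w` by `z` is a root of `a`.
  -- The inverse `c` of `z` exists because `p ∣ z` would give `p ∣ b`.
  square-/ : ∀ {a b} → p ∤ b → SquareMod p (a * b) → SquareMod p b → SquareMod p a
  square-/ {a} {b} p∤b (w , w²≡ab) (z , z²≡b)
    with inverse (p∤b ∘ ≈-resp-∣ (mk {z * z} z²≡b) ∘ ∣m⇒∣m*n z)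
  ... | c , cz≈1 = c * w , %-≡ (begin
    c * w * (c * w)        ≡⟨ rearrange₁ c w ⟩
    c * c * (w * w)        ≈⟨ *-congˡ (c * c) {w * w} {a * b} (mk w²≡ab) ⟩
    c * c * (a * b)        ≈⟨ *-congˡ (c * c) (*-congˡ a {z * z} {b} (mk z²≡b)) ⟨
    c * c * (a * (z * z))  ≡⟨ rearrange₂ a c z ⟩
    a * (c * z * (c * z))  ≈⟨ *-congˡ a (*-cong cz≈1 cz≈1) ⟩
    a * 1                  ≡⟨ ℕ.*-identityʳ a ⟩
    a                      ∎)
    where
    rearrange₁ : ∀ c w → c * w * (c * w) ≡ c * c * (w * w)
    rearrange₁ = solve-∀
    rearrange₂ : ∀ a c z → c * c * (a * (z * z)) ≡ a * (c * z * (c * z))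
    rearrange₂ = solve-∀

-- Counting square roots and summing the Legendre symbol for an odd prime.

module OddPrime (p : ℕ) .{{_ : NonZero p}} (prime : Prime p) (p≢2 : p ≢ 2) where

  open Modular p
  open PrimeModulus p prime
  open ≡-Reasoning

  p∤2 : p ∤ 2
  p∤2 p∣2 with prime⇒irreducible prime[2] p∣2
  ... | inj₁ refl = ¬prime[1] prime
  ... | inj₂ p≡2  = p≢2 p≡2

  -- The roots are 0 alone when `p ∣ a`, none for a nonsquare, and the two distinct classes of `z`
  -- and `neg z` for a square.
  count-square-roots : ∀ a → ∑ℤ (λ (y : Fin p) → 𝟙 (toℕ y * toℕ y ≈? a)) ≡ 1ℤ ℤ.+ legendre p a
  count-square-roots a with character a
  ... | multiple p∣a eq rewrite eq =
    trans (sum-cong-≗ {p} λ y → 𝟙-cong (_ ≈? a) (toℕ y ≈? 0) (⇒ _) (⇐ _)) (count-≈ 0)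
    where
    ⇒ : ∀ y → y * y ≈ a → y ≈ 0
    ⇒ y e = ∣⇒≈0 (reduce (euclidsLemma y y prime (≈-resp-∣ (≈-sym e) p∣a)))
    ⇐ : ∀ y → y ≈ 0 → y * y ≈ a
    ⇐ y e = ≈-trans (*-cong e e) (≈-sym (∣⇒≈0 p∣a))
  ... | nonsquare p∤a ¬s eq rewrite eq =
    ∑ℤ-zero (λ (y : Fin p) → 𝟙 (toℕ y * toℕ y ≈? a))
      λ y → 𝟙-false (_ ≈? a) λ e → ¬s (toℕ y , %-≡ e)
  ... | square p∤a (z , z²≡a) eq rewrite eq = begin
    ∑ℤ (λ (y : Fin p) → 𝟙 (toℕ y * toℕ y ≈? a))
      ≡⟨ sum-cong-≗ {p} (λ y → 𝟙-⊎ (_ ≈? a) (toℕ y ≈? z) (toℕ y ≈? neg z)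
           (λ e → square-roots (≈-trans e (≈-sym z²≈a)))
           (λ e → ≈-trans (*-cong e e) z²≈a)
           (λ e → ≈-trans (*-cong e e) (≈-trans (neg-*-neg z) z²≈a))
           (λ e e′ → ≉-neg p∤2 p∤z (≈-trans (≈-sym e) e′))) ⟩
    ∑ℤ (λ (y : Fin p) → 𝟙 (toℕ y ≈? z) ℤ.+ 𝟙 (toℕ y ≈? neg z))
      ≡⟨ ∑-distrib-+ {p} (λ y → 𝟙 (toℕ y ≈? z)) (λ y → 𝟙 (toℕ y ≈? neg z)) ⟩
    ∑ℤ (λ (y : Fin p) → 𝟙 (toℕ y ≈? z)) ℤ.+ ∑ℤ (λ (y : Fin p) → 𝟙 (toℕ y ≈? neg z))
      ≡⟨ cong₂ ℤ._+_ (count-≈ z) (count-≈ (neg z)) ⟩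
    1ℤ ℤ.+ 1ℤ ∎
    where
    z²≈a : z * z ≈ a
    z²≈a = mk z²≡a
    p∤z : p ∤ z
    p∤z d = p∤a (≈-resp-∣ z²≈a (∣m⇒∣m*n z d))

  -- Double counting of the pairs with `y * y ≈ a * x`. The common total is never evaluated: it
  -- stays `∑ 1` on both ends of the chain, and a summand that leaves it unchanged must be 0.
  ∑-legendre-* : ∀ {a} → p ∤ a → ∑ℤ (λ (x : Fin p) → legendre p (a * toℕ x)) ≡ 0ℤ
  ∑-legendre-* {a} p∤a = ℤ+.identityʳ-unique _ _ (begin
    ∑ℤ (λ (_ : Fin p) → 1ℤ) ℤ.+ ∑ℤ (λ (x : Fin p) → legendre p (a * toℕ x))
      ≡⟨ ∑-distrib-+ {p} (λ _ → 1ℤ) _ ⟨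
    ∑ℤ (λ (x : Fin p) → 1ℤ ℤ.+ legendre p (a * toℕ x))
      ≡⟨ sum-cong-≗ {p} (λ x → count-square-roots (a * toℕ x)) ⟨
    ∑ℤ (λ (x : Fin p) → ∑ℤ (λ (y : Fin p) → 𝟙 (toℕ y * toℕ y ≈? a * toℕ x)))
      ≡⟨ ∑-comm {p} {p} (λ x y → 𝟙 (toℕ y * toℕ y ≈? a * toℕ x)) ⟩
    ∑ℤ (λ (y : Fin p) → ∑ℤ (λ (x : Fin p) → 𝟙 (toℕ y * toℕ y ≈? a * toℕ x)))
      ≡⟨ sum-cong-≗ {p} (λ y → count-*-≈ p∤a (toℕ y * toℕ y)) ⟩
    ∑ℤ (λ (_ : Fin p) → 1ℤ) ∎)

  ∑-legendre : ∑ℤ (λ (x : Fin p) → legendre p (toℕ x)) ≡ 0ℤ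
  ∑-legendre = trans (sum-cong-≗ {p} λ x → cong (legendre p) (sym (ℕ.*-identityˡ (toℕ x))))
    (∑-legendre-* p∤1)

  -- Multiplicativity of the Legendre symbol.

  legendre-≤1 : ∀ a → legendre p a ℤ.≤ 1ℤ
  legendre-≤1 a with character a
  ... | multiple _ eq    rewrite eq = +≤+ z≤n
  ... | square _ _ eq    rewrite eq = ℤ.≤-refl
  ... | nonsquare _ _ eq rewrite eq = -≤+

  -- Were the product a square, dividing it by the square `b` would make `a` one too.
  legendre-nonsquare-*-square : ∀ {a b} → p ∤ a → ¬ SquareMod p a → p ∤ b → SquareMod p b →
                                legendre p (a * b) ≡ -1ℤ
  legendre-nonsquare-*-square p∤a ¬s p∤b s =
    legendre-nonsquare (p∤* p∤a p∤b) λ ab → ¬s (square-/ p∤b ab s)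

  -- χ (a x) + χ x is never positive and sums to 0 over x, so it vanishes identically.
  legendre-nonsquare-* : ∀ {a} → p ∤ a → ¬ SquareMod p a →
                         ∀ b → legendre p (a * b) ≡ ℤ.- legendre p b
  legendre-nonsquare-* {a} p∤a ¬s b = begin
    legendre p (a * b)              ≡⟨ legendre-cong (*-congˡ a (toℕ-toFin b)) ⟨
    legendre p (a * toℕ (toFin b))
      ≡⟨ ℤ+.inverseˡ-unique _ _ (∑ℤ-nonPos-≡0 _ (λ x → term≤0 (toℕ x)) ∑≡0 (toFin b)) ⟩
    ℤ.- legendre p (toℕ (toFin b))  ≡⟨ cong (ℤ.-_) (legendre-cong (toℕ-toFin b)) ⟩
    ℤ.- legendre p b                ∎
    where
    term≤0 : ∀ x → legendre p (a * x) ℤ.+ legendre p x ℤ.≤ 0ℤ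
    term≤0 x with character x
    ... | multiple p∣x eq
      rewrite eq | legendre-∣ (∣n⇒∣m*n a p∣x) = ℤ.≤-refl
    ... | square p∤x s eq
      rewrite eq | legendre-nonsquare-*-square p∤a ¬s p∤x s = ℤ.≤-refl
    -- The product of two nonsquares is the case still unknown; as the second term is -1, the bound
    -- `legendre-≤1` on the first suffices.
    ... | nonsquare _ _ eq
      rewrite eq = ℤ.+-monoˡ-≤ -1ℤ (legendre-≤1 (a * x))

    ∑≡0 : ∑ℤ (λ (x : Fin p) → legendre p (a * toℕ x) ℤ.+ legendre p (toℕ x)) ≡ 0ℤ
    ∑≡0 = trans (∑-distrib-+ {p} _ _) (cong₂ ℤ._+_ (∑-legendre-* p∤a) ∑-legendre)

  -- Two squares multiply through their roots, a mixed pair reduces to division by a square, and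
  -- only two nonsquares call for the counting argument.
  legendre-* : ∀ {a b} → p ∤ a → p ∤ b → legendre p (a * b) ≡ legendre p a ℤ.* legendre p b
  legendre-* {a} {b} p∤a p∤b with character a | character b
  ... | multiple p∣a _     | _                  = contradiction p∣a p∤a
  ... | _                  | multiple p∣b _     = contradiction p∣b p∤b
  ... | square _ s eq      | square _ s′ eq′    rewrite eq | eq′ =
    legendre-square (p∤* p∤a p∤b) (square-* {a} {b} s s′)
  ... | square _ s eq      | nonsquare _ ¬s eq′ rewrite eq | eq′ =
    trans (cong (legendre p) (ℕ.*-comm a b)) (legendre-nonsquare-*-square p∤b ¬s p∤a s)
  ... | nonsquare _ ¬s eq  | square _ s eq′     rewrite eq | eq′ =
    legendre-nonsquare-*-square p∤a ¬s p∤b s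
  ... | nonsquare _ ¬s eq  | nonsquare _ _ eq′  rewrite eq =
    trans (legendre-nonsquare-* p∤a ¬s b) (sym (ℤ.-1*i≡-i (legendre p b)))

  -- From the Legendre symbol to `λₚ` through prime factorisations.

  legendre-1 : legendre p 1 ≡ 1ℤ
  legendre-1 = legendre-square p∤1 (1 , refl)

  inert? : ∀ q → Dec (legendre p q ≡ -1ℤ)
  inert? q = legendre p q ℤ.≟ -1ℤ

  -- On the factor list of `n` this is `λₚ p n` by definition; allowing any list makes induction on
  -- the factors possible.
  sign : List ℕ → ℤ
  sign qs = -1ℤ ℤ.^ length (filter inert? qs)

  sign-∷ : ∀ {q} → p ∤ q → ∀ qs → sign (q ∷ qs) ≡ legendre p q ℤ.* sign qs
  sign-∷ {q} p∤q qs with character q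
  ... | multiple p∣q _   = contradiction p∣q p∤q
  ... | square _ _ eq    rewrite eq = sym (ℤ.*-identityˡ (sign qs))
  ... | nonsquare _ _ eq rewrite eq = refl

  sign-legendre : ∀ qs → p ∤ product qs → sign qs ≡ legendre p (product qs)
  sign-legendre []       _   = sym legendre-1
  sign-legendre (q ∷ qs) p∤Π = begin
    sign (q ∷ qs)                             ≡⟨ sign-∷ p∤q qs ⟩
    legendre p q ℤ.* sign qs                  ≡⟨ cong (legendre p q ℤ.*_) (sign-legendre qs p∤Πqs) ⟩
    legendre p q ℤ.* legendre p (product qs)  ≡⟨ legendre-* p∤q p∤Πqs ⟨
    legendre p (q * product qs)               ∎
    where
    p∤q : p ∤ q
    p∤q p∣q = p∤Π (∣m⇒∣m*n (product qs) p∣q)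
    p∤Πqs : p ∤ product qs
    p∤Πqs p∣Π = p∤Π (∣n⇒∣m*n q p∣Π)

  λₚ-legendre : ∀ n .{{_ : NonZero n}} → p ∤ n → λₚ p n ≡ legendre p n
  λₚ-legendre n p∤n = trans (sign-legendre (factors f) (subst (p ∤_) n≡Π p∤n))
    (cong (legendre p) (sym n≡Π))
    where
    f = factorise n
    n≡Π = PrimeFactorisation.isFactorisation f

  -- Prepending `p` to the factors of `m` gives a factorisation of `n`, unique up to permutation,
  -- and `p` is not counted because its symbol is 0. Taking the product as an equation lets `n` be a
  -- literal successor, as `λ⁺` requires.
  λₚ-p* : ∀ {m n} .{{_ : NonZero m}} .{{_ : NonZero n}} → n ≡ p * m → λₚ p n ≡ λₚ p m
  λₚ-p* {m} {n} n≡pm = trans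
    (cong (-1ℤ ℤ.^_) (↭-length (filter-↭ inert? (factorisationUnique (factorise n) p∷f))))
    sign-p
    where
    f = factorise m
    p∷f : PrimeFactorisation n
    p∷f = record
      { factors         = p ∷ factors f
      ; isFactorisation = trans n≡pm (cong (p *_) (PrimeFactorisation.isFactorisation f))
      ; factorsPrime    = prime ∷ PrimeFactorisation.factorsPrime f
      }
    sign-p : sign (p ∷ factors f) ≡ sign (factors f)
    sign-p rewrite legendre-∣ {p} ∣-refl = refl

  -- Sums over blocks of length `p` and the recursion on base `p` digits.

  λ⁺ : ℕ → ℤ
  λ⁺ i = λₚ p (suc i)

  -- The argument behind the index is `m * p + r + 1`. The bound leaves out the end of the block,
  -- `r + 1 = p`, where the symbol is 0 but `λₚ` is not.
  λ⁺-block : ∀ m {r} → suc r < p → λ⁺ (m * p + r) ≡ legendre p (suc r)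
  λ⁺-block m {r} r<p = trans (λₚ-legendre (suc (m * p + r)) p∤) (legendre-cong ≈suc)
    where
    ≈suc : suc (m * p + r) ≈ suc r
    ≈suc = ≈-trans (≈-reflexive (cong suc (ℕ.+-comm (m * p) r))) (+-multiple (suc r) m)
    p∤ : p ∤ suc (m * p + r)
    p∤ p∣ = >⇒∤ r<p (≈-resp-∣ ≈suc p∣)

  L-block : ∀ m {r} → r < p →
            L p (m * p + r) ≡ L p (m * p) ℤ.+ ∑ℤ {r} (λ i → legendre p (suc (toℕ i)))
  L-block m {r} r<p = trans (∑ℤ-+ (m * p) r λ⁺) (ℤ-+-congˡ (L p (m * p))
    (sum-cong-≗ {r} λ i → λ⁺-block m (ℕ.≤-<-trans (toℕ<n i) r<p)))

  ∑-legendre-suc : ∑ℤ {pred p} (λ i → legendre p (suc (toℕ i))) ≡ 0ℤ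
  ∑-legendre-suc = begin
    S                                         ≡⟨ ℤ.+-identityˡ S ⟨
    0ℤ ℤ.+ S                                  ≡⟨ cong (ℤ._+ S) (legendre-∣ (p ∣0)) ⟨
    ∑ℤ {suc (pred p)} (legendre p ∘ toℕ)      ≡⟨ cong (λ n → ∑ℤ {n} (legendre p ∘ toℕ)) (ℕ.suc-pred p) ⟩
    ∑ℤ {p} (legendre p ∘ toℕ)                 ≡⟨ ∑-legendre ⟩
    0ℤ                                        ∎
    where S = ∑ℤ {pred p} (λ i → legendre p (suc (toℕ i)))

  -- In each new block the first `pred p` arguments cancel, and the last, `suc m * p`, contributes
  -- `λₚ` at `suc m`: exactly the term by which `L p (suc m)` extends `L p m`.
  L-* : ∀ m → L p (m * p) ≡ L p m
  L-* zero    = refl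
  L-* (suc m) = begin
    L p (suc m * p)                     ≡⟨ cong (L p) [1+m]p ⟩
    L p (suc (m * p + pred p))          ≡⟨ ∑ℤ-snoc (m * p + pred p) λ⁺ ⟩
    L p (m * p + pred p) ℤ.+ λ⁺ (m * p + pred p)
      ≡⟨ cong₂ ℤ._+_ full (λₚ-p* (trans (sym [1+m]p) (ℕ.*-comm (suc m) p))) ⟩
    L p m ℤ.+ λ⁺ m                      ≡⟨ ∑ℤ-snoc m λ⁺ ⟨
    L p (suc m)                         ∎
    where
    [1+m]p : suc m * p ≡ suc (m * p + pred p)
    [1+m]p = begin
      p + m * p                ≡⟨ ℕ.+-comm p (m * p) ⟩
      m * p + p                ≡⟨ cong (m * p +_) (ℕ.suc-pred p) ⟨
      m * p + suc (pred p)     ≡⟨ ℕ.+-suc (m * p) (pred p) ⟩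
      suc (m * p + pred p)     ∎
    full : L p (m * p + pred p) ≡ L p m
    full = begin
      L p (m * p + pred p)     ≡⟨ L-block m (ℕ.≤-reflexive (ℕ.suc-pred p)) ⟩
      L p (m * p) ℤ.+ _        ≡⟨ cong₂ ℤ._+_ (L-* m) ∑-legendre-suc ⟩
      L p m ℤ.+ 0ℤ             ≡⟨ ℤ.+-identityʳ (L p m) ⟩
      L p m                    ∎

  L-+* : ∀ m {r} → r < p → L p (r + m * p) ≡ L p r ℤ.+ L p m
  L-+* m {r} r<p = begin
    L p (r + m * p)      ≡⟨ cong (L p) (ℕ.+-comm r (m * p)) ⟩
    L p (m * p + r)      ≡⟨ L-block m r<p ⟩
    -- Block number 0 has nothing before it, so `L-block 0` identifies `S` with `L p r`.
    L p (m * p) ℤ.+ S    ≡⟨ cong₂ ℤ._+_ (L-* m) (trans (sym (ℤ.+-identityˡ S)) (sym (L-block 0 r<p))) ⟩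
    L p m ℤ.+ L p r      ≡⟨ ℤ.+-comm (L p m) (L p r) ⟩
    L p r ℤ.+ L p m      ∎
    where S = ∑ℤ {r} (λ i → legendre p (suc (toℕ i)))

  -- Horner's scheme: a factor `p` is taken out of all digits but the lowest, and `L-+*` separates
  -- that digit from the shorter expansion `rest`. The induction starts from the empty expansion.
  L-digits : ∀ {k} (a : Fin k → Fin p) →
             L p (∑ℕ (λ j → toℕ (a j) * p ^ toℕ j)) ≡ ∑ℤ (λ j → L p (toℕ (a j)))
  L-digits {zero}  a = refl
  L-digits {suc k} a = begin
    L p (a₀ * 1 + ∑ℕ (λ j → toℕ (a (suc j)) * (p * p ^ toℕ j)))
      ≡⟨ cong (L p) (cong₂ _+_ (ℕ.*-identityʳ a₀) (trans
           (ℕ-sum-cong (λ j → rearrange (toℕ (a (suc j))) p (p ^ toℕ j)))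
           (∑ℕ-*ʳ p (λ j → toℕ (a (suc j)) * p ^ toℕ j)))) ⟩
    L p (a₀ + rest * p)
      ≡⟨ L-+* rest (toℕ<n (a zero)) ⟩
    L p a₀ ℤ.+ L p rest
      ≡⟨ ℤ-+-congˡ (L p a₀) (L-digits (a ∘ suc)) ⟩
    L p a₀ ℤ.+ ∑ℤ (λ j → L p (toℕ (a (suc j)))) ∎
    where
    a₀ = toℕ (a zero)
    rest = ∑ℕ (λ j → toℕ (a (suc j)) * p ^ toℕ j)
    rearrange : ∀ x p y → x * (p * y) ≡ x * y * p
    rearrange = solve-∀

theorem8 : ∀ (p : ℕ) .{{_ : NonZero p}} → Prime p → p ≢ 2 →
    ∀ (n : ℕ) .{{_ : NonZero n}} (k : ℕ) (a : Fin (suc k) → Fin p) →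
    n ≡ ∑ℕ (λ j → toℕ (a j) * p ^ toℕ j) →
    L p n ≡ ∑ℤ (λ j → L p (toℕ (a j)))
theorem8 p p-prime p≢2 n k a n≡ = trans (cong (L p) n≡) (OddPrime.L-digits p p-prime p≢2 a)
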